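{- Let $n,x$ be integers with $1<x<n$, so that $G=C_{2n}(x,1,n)$ is a $5$-regular circulant graph. If $n\equiv 2 \pmod 3$, $x\equiv 1\pmod 3$ and $x<\tfrac{n}{2}$, then $G$ is word-representable.
   Context: Two distinct letters $x,y$ alternate in a word $w$ if, after deleting all other letters from $w$, the resulting word is of the form $xyxy\cdots$ or $yxyx\cdots$ (of even or odd length). A graph $G=(V,E)$ is word-representable if there is a word $w$ over the alphabet $V$, containing every letter of $V$ at least once, such that for all distinct $x,y\in V$, $xy\in E$ if and only if $x$ and $y$ alternate in $w$. For an integer $m$ and a set $R$ of positive integers each at most $m/2$, the circulant graph $C_m(R)$ has vertex set $\{0,1,\dots,m-1\}$, with $i$ and $j$ adjacent iff $\min(|i-j|,\,m-|i-j|)\in R$. $C_{2n}(x,1,n)$ denotes the circulant graph on $2n$ vertices with jump set $\{1,x,n\}$; it is $5$-regular exactly when $1<x<n$. -}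

module Defs where

open import Data.Fin.Base using (Fin; toℕ)
open import Data.Fin.Properties using (_≟_)
open import Data.List.Base using (List; []; _∷_; filter)
open import Data.List.Membership.Propositional using (_∈_)
open import Data.Nat.Base
open import Data.Nat.Properties
  using (∣-∣-comm; ∣n-n∣≡0; ≤-refl; ≤-trans; <⇒≤; *-monoʳ-≤)
open import Data.Product.Base using (_×_; _,_; ∃-syntax; proj₁)
open import Data.Sum.Base using (_⊎_; inj₁; inj₂)
open import Function.Bundles using (_⇔_)
open import Level using (0ℓ)
open import Relation.Binary.Core using (Rel)
open import Relation.Binary.Definitions using (Symmetric; Irreflexive)
open import Relation.Binary.PropositionalEquality
  using (_≡_; _≢_; refl; cong; subst)
open import Relation.Nullary.Decidable using (_⊎-dec_)
open import Relation.Nullary.Negation using (¬_)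
open import Relation.Unary using (Pred; ｛_｝; _∪_)

record Graph (m : ℕ) : Set₁ where
  field
    Adj        : Rel (Fin m) 0ℓ
    Adj-sym    : Symmetric Adj
    Adj-irrefl : Irreflexive _≡_ Adj

restrict : ∀ {m} → Fin m → Fin m → List (Fin m) → List (Fin m)
restrict x y = filter (λ z → (z ≟ x) ⊎-dec (z ≟ y))

-- alternating x y k is the word xyxy⋯ of length k.
alternating : ∀ {A : Set} → A → A → ℕ → List A
alternating x y zero    = []
alternating x y (suc k) = x ∷ alternating y x k

Alternate : ∀ {m} → Fin m → Fin m → List (Fin m) → Set
Alternate x y w =
  ∃[ k ] (restrict x y w ≡ alternating x y k ⊎ restrict x y w ≡ alternating y x k)

Represents : ∀ {m} → List (Fin m) → Graph m → Set
Represents w G =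
  (∀ v → v ∈ w) × (∀ x y → x ≢ y → Graph.Adj G x y ⇔ Alternate x y w)

WordRepresentable : ∀ {m} → Graph m → Set
WordRepresentable G = ∃[ w ] Represents w G

-- 2 * r ≤ m expresses r ≤ m/2 without rounding.
IsJumpSet : ℕ → Pred ℕ 0ℓ → Set
IsJumpSet m R = ∀ r → R r → 1 ≤ r × 2 * r ≤ m

circularDistance : ∀ {m} → Fin m → Fin m → ℕ
circularDistance {m} i j = ∣ toℕ i - toℕ j ∣ ⊓ (m ∸ ∣ toℕ i - toℕ j ∣)

circulant : (m : ℕ) (R : Pred ℕ 0ℓ) → IsJumpSet m R → Graph m
circulant m R jumps = record
  { Adj        = λ i j → R (circularDistance i j)
  ; Adj-sym    = λ {i} {j} → subst R
      (cong (λ d → d ⊓ (m ∸ d)) (∣-∣-comm (toℕ i) (toℕ j)))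
  ; Adj-irrefl = λ { {i} refl r → ¬R0
      (subst R (cong (λ d → d ⊓ (m ∸ d)) (∣n-n∣≡0 (toℕ i))) r) }
  }
  where
  ¬R0 : ¬ R 0
  ¬R0 r with () ← proj₁ (jumps 0 r)

jumpSet : ∀ {n x} → 1 < x → x < n → IsJumpSet (2 * n) (｛ x ｝ ∪ ｛ 1 ｝ ∪ ｛ n ｝)
jumpSet 1<x x<n _ (inj₁ refl)        = <⇒≤ 1<x , *-monoʳ-≤ 2 (<⇒≤ x<n)
jumpSet 1<x x<n _ (inj₂ (inj₁ refl)) = ≤-refl , *-monoʳ-≤ 2 (<⇒≤ (≤-trans 1<x (<⇒≤ x<n)))
jumpSet 1<x x<n _ (inj₂ (inj₂ refl)) = <⇒≤ (≤-trans 1<x (<⇒≤ x<n)) , ≤-refl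

C₂ₙ[_,1,_] : (x n : ℕ) → 1 < x → x < n → Graph (2 * n)
C₂ₙ[ x ,1, n ] 1<x x<n = circulant (2 * n) (｛ x ｝ ∪ ｛ 1 ｝ ∪ ｛ n ｝) (jumpSet 1<x x<n)

{-# OPTIONS --safe #-}

-- The graph is 3-colourable, and every 3-colourable graph is word-representable.
--
-- Colouring.  Write n = 2x + 3d with d ≥ 1 and colour i by i + ⌊ki/2n⌋ modulo 3, where
-- k = 12j + 5 and j = ⌊5x/18d⌋.  Since 2n + k ≡ 0 (mod 3) this is well defined modulo 2n.
-- A jump r changes the colour by r + ⌊kr/2n⌋ or by one more, and the choice of j puts
-- kr/2n into [q, q + 1] with r + q ≡ 1 (mod 3) for each of r = 1, x, n.
--
-- Word.  Orient every edge from the smaller to the larger colour.  For each vertex v take a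
-- block, written in terms of v, the colour classes, and the neighbours and non-neighbours of v,
-- which restricts to xyxy⋯xy for every edge x → y, and which for every non-neighbour u of v
-- with colour at most that of v restricts to a word in u, v containing uu or vv.
-- The concatenation of these blocks represents the graph.
module Submission where

open import Defs
open import Data.Bool.Base using (if_then_else_)
open import Data.Fin.Base as Fin using (Fin; toℕ)
open import Data.Fin.Patterns using (0F; 1F; 2F)
import Data.Fin.Properties as Fin
open import Data.List.Base
  using (List; []; _∷_; [_]; _++_; map; concatMap; filter; allFin)
open import Data.List.Membership.Propositional using (_∈_; lose)
open import Data.List.Membership.Propositional.Properties
  using (∈-allFin; ∈-concatMap⁺; ∈-filter⁺; ∈-filter⁻)
open import Data.List.Properties
  using (≡-dec; filter-++; filter-none; filter-≐)
open import Data.List.Relation.Unary.All as All using ([]; _∷_)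
open import Data.List.Relation.Unary.AllPairs using ([]; _∷_)
open import Data.List.Relation.Unary.Any using (here; there)
open import Data.List.Relation.Unary.Linked as Linked using (Linked; []; [-]; _∷_; linked?)
import Data.List.Relation.Unary.Linked.Properties as Linked
open import Data.List.Relation.Unary.Unique.Propositional using (Unique)
open import Data.List.Relation.Unary.Unique.Propositional.Properties using (allFin⁺; filter⁺)
open import Data.Nat.Base
open import Data.Nat.Divisibility using (divides-refl)
open import Data.Nat.DivMod
open import Data.Nat.Properties
open import Data.Nat.Tactic.RingSolver using (solve-∀)
open import Data.Product.Base using (_×_; _,_; ∃-syntax; proj₁; proj₂)
import Data.Product.Properties as Product
open import Data.Sum.Base using (_⊎_; inj₁; inj₂; swap)
open import Function.Base using (_∘_)
open import Function.Bundles using (mk⇔)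
open import Level using (0ℓ)
open import Relation.Binary.Definitions using (Decidable; DecidableEquality; tri<; tri≈; tri>)
open import Relation.Binary.PropositionalEquality hiding ([_])
open import Relation.Nullary.Decidable
  using (Dec; yes; no; does; _×-dec_; _⊎-dec_; _→-dec_; ¬?; toWitness; dec-true; dec-false;
         decidable-stable)
open import Relation.Nullary.Negation using (¬_; contradiction)
open import Relation.Unary using (Pred; ｛_｝; _∪_)
import Relation.Unary as Unary
open import Algebra.Properties.CommutativeSemigroup +-commutativeSemigroup using (interchange)

-- Linked lists, filters and alternating words.

module _ {A : Set} where

  Linked-++⁻ˡ : ∀ {R : A → A → Set} xs {ys} → Linked R (xs ++ ys) → Linked R xs
  Linked-++⁻ˡ []           _        = []
  Linked-++⁻ˡ (x ∷ [])     _        = [-]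
  Linked-++⁻ˡ (x ∷ y ∷ xs) (r ∷ rs) = r ∷ Linked-++⁻ˡ (y ∷ xs) rs

  Linked-++⁻ʳ : ∀ {R : A → A → Set} xs {ys} → Linked R (xs ++ ys) → Linked R ys
  Linked-++⁻ʳ []       rs = rs
  Linked-++⁻ʳ (x ∷ xs) rs = Linked-++⁻ʳ xs (Linked.tail rs)

  filter-singleton : ∀ {P : Pred A 0ℓ} (P? : Unary.Decidable P) {x xs} → Unique xs → x ∈ xs →
                     P x → (∀ {u} → u ∈ xs → P u → u ≡ x) → filter P? xs ≡ [ x ]
  filter-singleton P? {x} {y ∷ ys} (y∉ys ∷ _) (here refl) Px only with P? x
  ... | yes _  = cong (x ∷_) (filter-none P?
                   (All.tabulate λ u∈ys Pu → All.lookup y∉ys u∈ys (sym (only (there u∈ys) Pu))))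
  ... | no ¬Px = contradiction Px ¬Px
  filter-singleton P? {x} {y ∷ ys} (y∉ys ∷ unique) (there x∈ys) Px only with P? y
  ... | yes Py = contradiction (only (here refl) Py) (All.lookup y∉ys x∈ys)
  ... | no _   = filter-singleton P? unique x∈ys Px (only ∘ there)

  alternating-linked : ∀ {x y : A} → x ≢ y → ∀ k → Linked _≢_ (alternating x y k)
  alternating-linked x≢y zero          = []
  alternating-linked x≢y (suc zero)    = [-]
  alternating-linked x≢y (suc (suc k)) = x≢y ∷ alternating-linked (≢-sym x≢y) (suc k)

  alternating-++ : ∀ (x y : A) k l →
    alternating x y (k * 2) ++ alternating x y (l * 2) ≡ alternating x y ((k + l) * 2)
  alternating-++ x y zero    l = refl
  alternating-++ x y (suc k) l = cong (λ w → x ∷ y ∷ w) (alternating-++ x y k l)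

map-alternating : ∀ {A B : Set} (f : A → B) x y k →
                  map f (alternating x y k) ≡ alternating (f x) (f y) k
map-alternating f x y zero    = refl
map-alternating f x y (suc k) = cong (f x ∷_) (map-alternating f y x k)

-- Alternation in concatenations of blocks.

module _ {m : ℕ} where

  restrict-sym : ∀ (x y : Fin m) w → restrict x y w ≡ restrict y x w
  restrict-sym x y = filter-≐ _ _ (swap , swap)

  Alternate-sym : ∀ {x y : Fin m} w → Alternate x y w → Alternate y x w
  Alternate-sym {x} {y} w (k , inj₁ eq) = k , inj₂ (trans (restrict-sym y x w) eq)
  Alternate-sym {x} {y} w (k , inj₂ eq) = k , inj₁ (trans (restrict-sym y x w) eq)

  Alternate⇒linked : ∀ {x y : Fin m} w → x ≢ y → Alternate x y w → Linked _≢_ (restrict x y w)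
  Alternate⇒linked w x≢y (k , inj₁ eq) = subst (Linked _≢_) (sym eq) (alternating-linked x≢y k)
  Alternate⇒linked w x≢y (k , inj₂ eq) =
    subst (Linked _≢_) (sym eq) (alternating-linked (≢-sym x≢y) k)

  -- Even length and a fixed first letter let such words be concatenated without breaking the
  -- alternation.
  EvenAlternating : Fin m → Fin m → List (Fin m) → Set
  EvenAlternating x y w = ∃[ k ] restrict x y w ≡ alternating x y (k * 2)

  evenAlternating-concatMap : ∀ {A : Set} {x y} (f : A → List (Fin m)) →
    (∀ v → EvenAlternating x y (f v)) → ∀ vs → EvenAlternating x y (concatMap f vs)
  evenAlternating-concatMap             f even []       = 0 , refl
  evenAlternating-concatMap {x = x} {y} f even (v ∷ vs) =
    let k , eq  = even v
        l , eq′ = evenAlternating-concatMap f even vs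
    in k + l , trans (filter-++ _ (f v) _) (trans (cong₂ _++_ eq eq′) (alternating-++ x y k l))

  -- Having no two equal consecutive letters passes to factors, so a repetition in a single block
  -- already rules out alternation in the whole word.
  linked-concatMap⁻ : ∀ {A : Set} {x y} (f : A → List (Fin m)) {v vs} → v ∈ vs →
    Linked _≢_ (restrict x y (concatMap f vs)) → Linked _≢_ (restrict x y (f v))
  linked-concatMap⁻ f {v} {vs} (here refl) linked =
    Linked-++⁻ˡ _ (subst (Linked _≢_) (filter-++ _ (f v) _) linked)
  linked-concatMap⁻ {x = x} {y} f {vs = u ∷ vs} (there v∈vs) linked =
    linked-concatMap⁻ f v∈vs
      (Linked-++⁻ʳ (restrict x y (f u)) (subst (Linked _≢_) (filter-++ _ (f u) _) linked))

-- From words over roles to words over vertices.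

restrictOn : ∀ {A : Set} → DecidableEquality A → A → A → List A → List A
restrictOn _≟_ a b = filter (λ s → (s ≟ a) ⊎-dec (s ≟ b))

module BlowUp {m : ℕ} {Role : Set} (_≟ᵣ_ : DecidableEquality Role) (role : Fin m → Role) where

  blowUp : List Role → List (Fin m)
  blowUp = concatMap (λ s → filter (λ u → role u ≟ᵣ s) (allFin m))

  ∈-blowUp : ∀ {u} {T} → role u ∈ T → u ∈ blowUp T
  ∈-blowUp {u} r∈T = ∈-concatMap⁺ _ (lose r∈T (∈-filter⁺ _ (∈-allFin u) refl))

  module _ {x y : Fin m} (rx≢ry : role x ≢ role y) where

    -- The default `y` is harmless: `name` is applied only to words restricted to the roles of `x`
    -- and `y`.
    name : Role → Fin m
    name s = if does (s ≟ᵣ role x) then x else y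

    name-x : name (role x) ≡ x
    name-x rewrite dec-true (role x ≟ᵣ role x) refl = refl

    name-y : name (role y) ≡ y
    name-y rewrite dec-false (role y ≟ᵣ role x) (≢-sym rx≢ry) = refl

    private
      class : Role → List (Fin m)
      class s = filter (λ u → role u ≟ᵣ s) (allFin m)

      role-class : ∀ {u s} → u ∈ class s → role u ≡ s
      role-class {s = s} u∈ = proj₂ (∈-filter⁻ (λ u → role u ≟ᵣ s) {xs = allFin m} u∈)

      unique-class : ∀ s → Unique (class s)
      unique-class s = filter⁺ _ (allFin⁺ m)

    -- Since the two roles differ, the class of each role contains at most one of `x` and `y`, and
    -- restriction leaves that letter once or nothing. Alternation of vertices thus becomes a
    -- question about finitely many roles.
    restrict-blowUp : ∀ T → restrict x y (blowUp T) ≡ map name (restrictOn _≟ᵣ_ (role x) (role y) T)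
    restrict-blowUp []      = refl
    restrict-blowUp (s ∷ T)
      rewrite filter-++ (λ z → (z Fin.≟ x) ⊎-dec (z Fin.≟ y)) (class s) (blowUp T)
            | restrict-blowUp T
      with s ≟ᵣ role x | s ≟ᵣ role y
    ... | yes refl | _ = cong₂ _++_ (trans only-x (cong [_] (sym name-x))) refl
      where
      only-x : restrict x y (class (role x)) ≡ [ x ]
      only-x = filter-singleton _ (unique-class _) (∈-filter⁺ _ (∈-allFin x) refl) (inj₁ refl)
        λ { u∈ (inj₁ u≡x)  → u≡x
          ; u∈ (inj₂ refl) → contradiction (sym (role-class u∈)) rx≢ry }
    ... | no _ | yes refl = cong₂ _++_ (trans only-y (cong [_] (sym name-y))) refl
      where
      only-y : restrict x y (class (role y)) ≡ [ y ]
      only-y = filter-singleton _ (unique-class _) (∈-filter⁺ _ (∈-allFin y) refl) (inj₂ refl)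
        λ { u∈ (inj₁ refl) → contradiction (role-class u∈) rx≢ry
          ; u∈ (inj₂ u≡y)  → u≡y }
    ... | no s≢rx | no s≢ry = cong₂ _++_ (filter-none _ {xs = class s} (All.tabulate
        λ { u∈ (inj₁ refl) → s≢rx (sym (role-class u∈))
          ; u∈ (inj₂ refl) → s≢ry (sym (role-class u∈)) })) refl

-- Block templates and their finite verification.

pattern self   = 0F
pattern joined = 1F
pattern apart  = 2F

-- The colour of a vertex and its relation to the vertex v of the block.
Role : Set
Role = Fin 3 × Fin 3

_≟ᵣ_ : DecidableEquality Role
_≟ᵣ_ = Product.≡-dec Fin._≟_ Fin._≟_

others : Fin 3 → List Role
others a = (a , joined) ∷ (a , apart) ∷ []

-- In the templates for colours 0 and 1, both occurrences of an apart role of colour at most that of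
-- `self` lie between the two occurrences of `self`. The first two lines for colour 2 do the same
-- with the apart roles of colours 1 and 2.
template : Fin 3 → List Role
template 0F = (0F , self) ∷ others 0F ++ others 1F ++ others 2F
           ++ others 0F ++ (0F , self) ∷ others 1F ++ others 2F
template 1F = (0F , joined) ∷ (1F , self) ∷ (0F , apart) ∷ others 1F ++ others 2F
           ++ others 0F ++ others 1F ++ (1F , self) ∷ others 2F
-- An apart vertex of colour 0 may be connected to v through colour 1 and then cannot be moved
-- past v within a linear extension; the last two lines, in which each letter occurs twice,
-- place both of its occurrences before those of v.
template 2F = others 0F ++ (1F , joined) ∷ (2F , self) ∷ (1F , apart) ∷ others 2F
           ++ others 0F ++ others 1F ++ others 2F ++ (2F , self)
            ∷ (0F , apart) ∷ (0F , joined) ∷ others 1F ++ others 2F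
           ++ (0F , apart) ∷ (2F , self) ∷ (0F , joined) ∷ others 1F ++ (2F , self) ∷ others 2F

-- How often each role that a vertex can have occurs in the template.
period : Fin 3 → ℕ
period 0F = 2
period 1F = 2
period 2F = 4

self∈template : ∀ c → (c , self) ∈ template c
self∈template 0F = here refl
self∈template 1F = there (here refl)
self∈template 2F = there (there (there (here refl)))

-- Only v has the role `self`: if one end of an edge is v, then that end has colour `c` and the
-- other end is joined. The two conditions on `self` record this; the remaining cases are finitely
-- many and are settled by evaluation.
template-edge? : Dec (∀ c a b r s → a Fin.< b →
  (r ≡ self → a ≡ c × s ≡ joined) → (s ≡ self → b ≡ c × r ≡ joined) →
  restrictOn _≟ᵣ_ (a , r) (b , s) (template c) ≡ alternating (a , r) (b , s) (period c * 2))
template-edge? =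
  Fin.all? λ c → Fin.all? λ a → Fin.all? λ b → Fin.all? λ r → Fin.all? λ s →
    (a Fin.<? b) →-dec
    ((r Fin.≟ self) →-dec ((a Fin.≟ c) ×-dec (s Fin.≟ joined))) →-dec
    ((s Fin.≟ self) →-dec ((b Fin.≟ c) ×-dec (r Fin.≟ joined))) →-dec
    ≡-dec _≟ᵣ_ _ _

-- The case `a ≤ c` suffices, because for a non-adjacent pair the block of an end with the larger
-- colour can be used. Equal colours are included, as such pairs must not alternate either.
template-nonedge? : Dec (∀ c a → a Fin.≤ c →
  ¬ Linked _≢_ (restrictOn _≟ᵣ_ (a , apart) (c , self) (template c)))
template-nonedge? =
  Fin.all? λ c → Fin.all? λ a →
    (a Fin.≤? c) →-dec ¬? (linked? (λ s t → ¬? (s ≟ᵣ t)) _)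

template-edge = toWitness {a? = template-edge?} _

template-nonedge = toWitness {a? = template-nonedge?} _

-- Word-representability of 3-coloured graphs.

module ThreeColoured {m : ℕ} (G : Graph m) (adj? : Decidable (Graph.Adj G))
  (colour : Fin m → Fin 3) (proper : ∀ {u v} → Graph.Adj G u v → colour u ≢ colour v) where

  open Graph G

  relation : Fin m → Fin m → Fin 3
  relation v u = if does (v Fin.≟ u) then self else if does (adj? v u) then joined else apart

  relation-self : ∀ v → relation v v ≡ self
  relation-self v rewrite dec-true (v Fin.≟ v) refl = refl

  relation-joined : ∀ {v u} → Adj v u → relation v u ≡ joined
  relation-joined {v} {u} vu
    rewrite dec-false (v Fin.≟ u) (λ v≡u → Adj-irrefl v≡u vu) | dec-true (adj? v u) vu = refl

  relation-apart : ∀ {v u} → v ≢ u → ¬ Adj v u → relation v u ≡ apart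
  relation-apart {v} {u} v≢u ¬vu
    rewrite dec-false (v Fin.≟ u) v≢u | dec-false (adj? v u) ¬vu = refl

  relation≡self⇒≡ : ∀ v u → relation v u ≡ self → v ≡ u
  relation≡self⇒≡ v u eq with v Fin.≟ u | adj? v u
  ... | yes v≡u | _ = v≡u
  relation≡self⇒≡ v u () | no _ | yes _
  relation≡self⇒≡ v u () | no _ | no _

  role : Fin m → Fin m → Role
  role v u = colour u , relation v u

  module Block (v : Fin m) = BlowUp _≟ᵣ_ (role v)

  block : Fin m → List (Fin m)
  block v = Block.blowUp v (template (colour v))

  word : List (Fin m)
  word = concatMap block (allFin m)

  ∈-word : ∀ v → v ∈ word
  ∈-word v = ∈-concatMap⁺ block (lose (∈-allFin v) (Block.∈-blowUp v self∈))
    where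
    self∈ : role v v ∈ template (colour v)
    self∈ rewrite relation-self v = self∈template (colour v)

  block-edge : ∀ {x y} → Adj x y → colour x Fin.< colour y → ∀ v → EvenAlternating x y (block v)
  block-edge {x} {y} xy cx<cy v = k , (begin
    restrict x y (block v)
      ≡⟨ restrict-blowUp rx≢ry (template (colour v)) ⟩
    map nm (restrictOn _≟ᵣ_ (role v x) (role v y) (template (colour v)))
      ≡⟨ cong (map nm) (template-edge (colour v) _ _ _ _ cx<cy
           (λ eq → case-x (relation≡self⇒≡ v x eq)) (λ eq → case-y (relation≡self⇒≡ v y eq))) ⟩
    map nm (alternating (role v x) (role v y) (k * 2))
      ≡⟨ map-alternating nm _ _ (k * 2) ⟩
    alternating (nm (role v x)) (nm (role v y)) (k * 2)
      ≡⟨ cong₂ (λ a b → alternating a b (k * 2)) (name-x rx≢ry) (name-y rx≢ry) ⟩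
    alternating x y (k * 2) ∎)
    where
    open ≡-Reasoning
    open Block v
    k = period (colour v)

    rx≢ry : role v x ≢ role v y
    rx≢ry eq = Fin.<⇒≢ cx<cy (cong proj₁ eq)

    nm = name rx≢ry

    case-x : v ≡ x → colour x ≡ colour v × relation v y ≡ joined
    case-x refl = refl , relation-joined xy

    case-y : v ≡ y → colour y ≡ colour v × relation v x ≡ joined
    case-y refl = refl , relation-joined (Adj-sym xy)

  block-nonedge : ∀ {x y} → x ≢ y → ¬ Adj x y → colour x Fin.≤ colour y →
                  ¬ Linked _≢_ (restrict x y (block y))
  block-nonedge {x} {y} x≢y ¬xy cx≤cy linked =
    template-nonedge (colour y) (colour x) cx≤cy (subst₂ Linked-roles rx≡ ry≡
      -- Equal roles have equal names, so a repeated role in the template would be a repeated vertex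
      -- in the block.
      (Linked.map (λ ≢ eq → ≢ (cong (name rx≢ry) eq))
        (Linked.map⁻ (subst (Linked _≢_) (restrict-blowUp rx≢ry (template (colour y))) linked))))
    where
    open Block y
    Linked-roles : Role → Role → Set
    Linked-roles a b = Linked _≢_ (restrictOn _≟ᵣ_ a b (template (colour y)))

    rx≡ : role y x ≡ (colour x , apart)
    rx≡ = cong (colour x ,_) (relation-apart (≢-sym x≢y) (¬xy ∘ Adj-sym))

    ry≡ : role y y ≡ (colour y , self)
    ry≡ = cong (colour y ,_) (relation-self y)

    rx≢ry : role y x ≢ role y y
    rx≢ry eq with () ← trans (sym (cong proj₂ rx≡)) (trans (cong proj₂ eq) (cong proj₂ ry≡))

  edge⇒Alternate : ∀ {x y} → Adj x y → colour x Fin.< colour y → Alternate x y word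
  edge⇒Alternate xy cx<cy =
    let k , eq = evenAlternating-concatMap block (block-edge xy cx<cy) (allFin m)
    in k * 2 , inj₁ eq

  nonedge⇒¬Alternate : ∀ {x y} → x ≢ y → ¬ Adj x y → colour x Fin.≤ colour y →
                       ¬ Alternate x y word
  nonedge⇒¬Alternate {y = y} x≢y ¬xy cx≤cy alt = block-nonedge x≢y ¬xy cx≤cy
    (linked-concatMap⁻ block (∈-allFin y) (Alternate⇒linked word x≢y alt))

  wordRepresentable : WordRepresentable G
  wordRepresentable = word , ∈-word , λ x y x≢y → mk⇔ to (from x≢y)
    where
    to : ∀ {x y} → Adj x y → Alternate x y word
    to {x} {y} xy with <-cmp (toℕ (colour x)) (toℕ (colour y))
    ... | tri< cx<cy _ _ = edge⇒Alternate xy cx<cy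
    ... | tri≈ _ cx≡cy _ = contradiction (Fin.toℕ-injective cx≡cy) (proper xy)
    ... | tri> _ _ cy<cx = Alternate-sym word (edge⇒Alternate (Adj-sym xy) cy<cx)

    from : ∀ {x y} → x ≢ y → Alternate x y word → Adj x y
    from {x} {y} x≢y alt = decidable-stable (adj? x y) λ ¬xy →
      case-≤ ¬xy (≤-total (toℕ (colour x)) (toℕ (colour y)))
      where
      case-≤ : ¬ Adj x y → ¬ (colour x Fin.≤ colour y ⊎ colour y Fin.≤ colour x)
      case-≤ ¬xy (inj₁ cx≤cy) = nonedge⇒¬Alternate x≢y ¬xy cx≤cy alt
      case-≤ ¬xy (inj₂ cy≤cx) = nonedge⇒¬Alternate (≢-sym x≢y) (¬xy ∘ Adj-sym) cy≤cx
                                  (Alternate-sym word alt)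

-- Residues modulo 3 and increments of floors.

shift-%3 : ∀ a b → b % 3 ≢ 0 → (a + b) % 3 ≢ a % 3
shift-%3 a b b≢0 eq = table (a % 3) (b % 3) (m%n<n a 3) (m%n<n b 3) b≢0
                        (trans (sym (%-distribˡ-+ a b 3)) eq)
  where
  table : ∀ a b → a < 3 → b < 3 → b ≢ 0 → (a + b) % 3 ≢ a
  table a 0 _ _ b≢0 _ = b≢0 refl
  table 0 1 _ _ _ ()
  table 0 2 _ _ _ ()
  table 1 1 _ _ _ ()
  table 1 2 _ _ _ ()
  table 2 1 _ _ _ ()
  table 2 2 _ _ _ ()
  table (suc (suc (suc _))) _ (s≤s (s≤s (s≤s ()))) _ _ _
  table _ (suc (suc (suc _))) _ (s≤s (s≤s (s≤s ()))) _ _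

-- Adding a multiple `p * M` raises the quotient by exactly `p`, and division is monotone. Hence the
-- upper bound may be attained without the increment exceeding `suc q`.
/-window : ∀ a b M q .{{_ : NonZero M}} → q * M ≤ b → b ≤ suc q * M →
           (a + b) / M ≡ a / M + q ⊎ (a + b) / M ≡ a / M + suc q
/-window a b M q lower upper = case-≤ (m≤n⇒m<n∨m≡n below)
  where
  shifted : ∀ p → (a + p * M) / M ≡ a / M + p
  shifted p = trans (+-distrib-/-∣ʳ a (divides-refl p)) (cong (a / M +_) (m*n/n≡m p M))

  above : a / M + q ≤ (a + b) / M
  above = ≤-trans (≤-reflexive (sym (shifted q))) (/-monoˡ-≤ M (+-monoʳ-≤ a lower))

  below : (a + b) / M ≤ a / M + suc q
  below = ≤-trans (/-monoˡ-≤ M (+-monoʳ-≤ a upper)) (≤-reflexive (shifted (suc q)))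

  case-≤ : (a + b) / M < a / M + suc q ⊎ (a + b) / M ≡ a / M + suc q →
           (a + b) / M ≡ a / M + q ⊎ (a + b) / M ≡ a / M + suc q
  case-≤ (inj₁ lt) = inj₁ (≤-antisym (s≤s⁻¹ (≤-trans lt (≤-reflexive (+-suc (a / M) q)))) above)
  case-≤ (inj₂ eq) = inj₂ eq

-- The 3-colouring of the circulant graph.

module Colouring (b d′ : ℕ) where

  -- Both `d` and `x` are successors, which makes the divisors `18 * d` and `2 * n` visibly nonzero.
  d x n j k : ℕ
  d = suc d′
  x = 1 + b * 3
  n = 2 * x + 3 * d
  j = 5 * x / (18 * d)
  k = 12 * j + 5

  j-lower : j * (18 * d) ≤ 5 * x
  j-lower = m/n*n≤m (5 * x) (18 * d)

  -- The floor gives 5x ≤ 18d(j + 1), and 18(j + 1) ≤ 5(18j + 6).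
  j-upper : x ≤ j * (18 * d) + 6 * d
  j-upper = *-cancelˡ-≤ 5 (begin
    5 * x                             ≡⟨ m≡m%n+[m/n]*n (5 * x) (18 * d) ⟩
    5 * x % (18 * d) + j * (18 * d)   ≤⟨ +-monoˡ-≤ _ (<⇒≤ (m%n<n (5 * x) (18 * d))) ⟩
    18 * d + j * (18 * d)             ≤⟨ m≤m+n _ _ ⟩
    18 * d + j * (18 * d) + (12 * d + 4 * (j * (18 * d)))
                                      ≡⟨ lemma d (j * (18 * d)) ⟩
    5 * (j * (18 * d) + 6 * d)        ∎)
    where
    open ≤-Reasoning
    lemma : ∀ d e → 18 * d + e + (12 * d + 4 * e) ≡ 5 * (e + 6 * d)
    lemma = solve-∀

  height : ℕ → ℕ
  height i = i + k * i / (2 * n)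

  Recolours : ℕ → Set
  Recolours r = ∀ i → height (i + r) % 3 ≢ height i % 3

  height-+ : ∀ i r e → (k * i + k * r) / (2 * n) ≡ k * i / (2 * n) + e →
             height (i + r) ≡ height i + (r + e)
  height-+ i r e eq = begin
    i + r + k * (i + r) / (2 * n)       ≡⟨ cong (λ e → i + r + e / (2 * n)) (*-distribˡ-+ k i r) ⟩
    i + r + (k * i + k * r) / (2 * n)   ≡⟨ cong (i + r +_) eq ⟩
    i + r + (k * i / (2 * n) + e)       ≡⟨ interchange i r _ e ⟩
    height i + (r + e)                  ∎
    where open ≡-Reasoning

  -- The height grows by r + q or r + q + 1, which are 1 and 2 modulo 3, so the colour never stays
  -- the same.
  recolours : ∀ r q t → q * (2 * n) ≤ k * r → k * r ≤ suc q * (2 * n) → r + q ≡ 1 + t * 3 →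
              Recolours r
  recolours r q t lower upper r+q≡ i eq
    with /-window (k * i) (k * r) (2 * n) q lower upper
  ... | inj₁ floor≡ = shift-%3 (height i) (r + q) ≢0
                        (trans (cong (_% 3) (sym (height-+ i r q floor≡))) eq)
    where
    ≢0 : (r + q) % 3 ≢ 0
    ≢0 ≡0 with () ← trans (sym ([m+kn]%n≡m%n 1 t 3)) (trans (cong (_% 3) (sym r+q≡)) ≡0)
  ... | inj₂ floor≡ = shift-%3 (height i) (r + suc q) ≢0
                        (trans (cong (_% 3) (sym (height-+ i r (suc q) floor≡))) eq)
    where
    r+1+q≡ : r + suc q ≡ 2 + t * 3
    r+1+q≡ = trans (+-suc r q) (cong suc r+q≡)
    ≢0 : (r + suc q) % 3 ≢ 0
    ≢0 ≡0 with () ← trans (sym ([m+kn]%n≡m%n 2 t 3)) (trans (cong (_% 3) (sym r+1+q≡)) ≡0)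

  -- With q = 0 the point is k ≤ 2n = 4x + 6d. As d ≥ 1, `j-lower` yields 12j ≤ 4x, and 5 ≤ 6d.
  recolours-1 : Recolours 1
  recolours-1 = recolours 1 0 0 z≤n upper refl
    where
    open ≤-Reasoning
    j≤x : 12 * j ≤ 4 * x
    j≤x = *-cancelˡ-≤ 3 (begin
      3 * (12 * j)        ≤⟨ m≤m+n _ (36 * (j * d′)) ⟩
      3 * (12 * j) + 36 * (j * d′) ≡⟨ lemma j d′ ⟩
      2 * (j * (18 * d))  ≤⟨ *-monoʳ-≤ 2 j-lower ⟩
      2 * (5 * x)         ≤⟨ m≤m+n _ (2 * x) ⟩
      2 * (5 * x) + 2 * x ≡⟨ lemma′ x ⟩
      3 * (4 * x)         ∎)
      where
      lemma : ∀ j d′ → 3 * (12 * j) + 36 * (j * d′) ≡ 2 * (j * (18 * (1 + d′)))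
      lemma = solve-∀
      lemma′ : ∀ x → 2 * (5 * x) + 2 * x ≡ 3 * (4 * x)
      lemma′ = solve-∀
    upper : k * 1 ≤ 1 * (2 * n)
    upper = begin
      k * 1                         ≡⟨ *-identityʳ k ⟩
      12 * j + 5                    ≤⟨ +-mono-≤ j≤x (m≤m+n 5 (1 + 6 * d′)) ⟩
      4 * x + (5 + (1 + 6 * d′))    ≡⟨ lemma x d′ ⟩
      1 * (2 * n)                   ∎
      where
      lemma : ∀ x d′ → 4 * x + (5 + (1 + 6 * d′)) ≡ 1 * (2 * (2 * x + 3 * (1 + d′)))
      lemma = solve-∀

  -- With q = 3j, cancelling 12jx turns the lower bound into `j-lower`; cancelling 12jx + 4x turns
  -- the upper bound into `j-upper`.
  recolours-x : Recolours x
  recolours-x = recolours x (3 * j) (b + j) lower upper (residue b j)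
    where
    open ≤-Reasoning
    residue : ∀ b j → 1 + b * 3 + 3 * j ≡ 1 + (b + j) * 3
    residue = solve-∀
    lower : 3 * j * (2 * n) ≤ k * x
    lower = begin
      3 * j * (2 * n)                   ≡⟨ lemma x d j ⟩
      12 * j * x + j * (18 * d)         ≤⟨ +-monoʳ-≤ (12 * j * x) j-lower ⟩
      12 * j * x + 5 * x                ≡⟨ *-distribʳ-+ x (12 * j) 5 ⟨
      k * x                             ∎
      where
      lemma : ∀ x d j → 3 * j * (2 * (2 * x + 3 * d)) ≡ 12 * j * x + j * (18 * d)
      lemma = solve-∀
    upper : k * x ≤ suc (3 * j) * (2 * n)
    upper = begin
      k * x                                             ≡⟨ lemma j x ⟩
      12 * j * x + 4 * x + x                            ≤⟨ +-monoʳ-≤ (12 * j * x + 4 * x) j-upper ⟩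
      12 * j * x + 4 * x + (j * (18 * d) + 6 * d)       ≡⟨ lemma′ x d j ⟩
      suc (3 * j) * (2 * n)                             ∎
      where
      lemma : ∀ j x → (12 * j + 5) * x ≡ 12 * j * x + 4 * x + x
      lemma = solve-∀
      lemma′ : ∀ x d j → 12 * j * x + 4 * x + (j * (18 * d) + 6 * d)
                       ≡ (1 + 3 * j) * (2 * (2 * x + 3 * d))
      lemma′ = solve-∀

  -- Since k is odd, kn/2n = 6j + 5/2 is the midpoint of [6j + 2, 6j + 3]; each bound therefore
  -- holds with slack exactly n.
  recolours-n : Recolours n
  recolours-n = recolours n (6 * j + 2) (1 + 2 * b + d + 2 * j)
    (≤-trans (m≤m+n _ n) (≤-reflexive (lower j n)))
    (≤-trans (m≤m+n _ n) (≤-reflexive (upper j n))) (residue b d j)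
    where
    residue : ∀ b d j → 2 * (1 + b * 3) + 3 * d + (6 * j + 2) ≡ 1 + (1 + 2 * b + d + 2 * j) * 3
    residue = solve-∀
    lower : ∀ j n → (6 * j + 2) * (2 * n) + n ≡ (12 * j + 5) * n
    lower = solve-∀
    upper : ∀ j n → (12 * j + 5) * n + n ≡ (1 + (6 * j + 2)) * (2 * n)
    upper = solve-∀

  -- One turn around the cycle adds 2n + k, where 2n ≡ 1 and k ≡ 2 modulo 3.
  height-periodic : ∀ i → height (i + 2 * n) % 3 ≡ height i % 3
  height-periodic i = begin
    height (i + 2 * n) % 3            ≡⟨ cong (_% 3) (height-+ i (2 * n) k floor≡) ⟩
    (height i + (2 * n + k)) % 3      ≡⟨ cong (λ e → (height i + e) % 3) (multiple b d j) ⟩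
    (height i + (3 + 4 * b + 2 * d + 4 * j) * 3) % 3
                                      ≡⟨ [m+kn]%n≡m%n (height i) (3 + 4 * b + 2 * d + 4 * j) 3 ⟩
    height i % 3                      ∎
    where
    open ≡-Reasoning
    floor≡ : (k * i + k * (2 * n)) / (2 * n) ≡ k * i / (2 * n) + k
    floor≡ = trans (+-distrib-/-∣ʳ (k * i) (divides-refl k))
                   (cong (k * i / (2 * n) +_) (m*n/n≡m k (2 * n)))
    multiple : ∀ b d j → 2 * (2 * (1 + b * 3) + 3 * d) + (12 * j + 5)
                       ≡ (3 + 4 * b + 2 * d + 4 * j) * 3
    multiple = solve-∀

  Jump : Pred ℕ 0ℓ
  Jump = ｛ x ｝ ∪ ｛ 1 ｝ ∪ ｛ n ｝

  jump? : Unary.Decidable Jump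
  jump? r = (x ≟ r) ⊎-dec (1 ≟ r) ⊎-dec (n ≟ r)

  jump-recolours : ∀ {r} → Jump r → Recolours r
  jump-recolours (inj₁ refl)        = recolours-x
  jump-recolours (inj₂ (inj₁ refl)) = recolours-1
  jump-recolours (inj₂ (inj₂ refl)) = recolours-n

  colour : Fin (2 * n) → Fin 3
  colour i = height (toℕ i) mod 3

  colour≡⇒height≡ : ∀ i j → colour i ≡ colour j → height (toℕ i) % 3 ≡ height (toℕ j) % 3
  colour≡⇒height≡ i j = Fin.fromℕ<-injective _ _ _ _

  proper-≤ : ∀ {i j} → Jump (circularDistance i j) → toℕ i ≤ toℕ j → colour i ≢ colour j
  proper-≤ {i} {j} jump i≤j c≡ with ⊓-sel (toℕ j ∸ toℕ i) (2 * n ∸ (toℕ j ∸ toℕ i))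
                                  | subst (λ e → Jump (e ⊓ (2 * n ∸ e))) (m≤n⇒∣m-n∣≡n∸m i≤j) jump
  ... | inj₁ eq | jump′ = jump-recolours (subst Jump eq jump′) (toℕ i)
    (trans (cong (λ e → height e % 3) (m+[n∸m]≡n i≤j)) (sym (colour≡⇒height≡ i j c≡)))
  -- Here the shorter arc passes through 0: the jump starts at `j` and ends at `i + 2n`, which has
  -- the colour of `i` by periodicity.
  ... | inj₂ eq | jump′ = jump-recolours (subst Jump eq jump′) (toℕ j)
    (trans (cong (λ e → height e % 3) around)
           (trans (height-periodic (toℕ i)) (colour≡⇒height≡ i j c≡)))
    where
    open ≡-Reasoning
    δ = toℕ j ∸ toℕ i
    δ≤2n : δ ≤ 2 * n
    δ≤2n = ≤-trans (m∸n≤m (toℕ j) (toℕ i)) (<⇒≤ (Fin.toℕ<n j))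
    around : toℕ j + (2 * n ∸ δ) ≡ toℕ i + 2 * n
    around = begin
      toℕ j + (2 * n ∸ δ)       ≡⟨ cong (_+ (2 * n ∸ δ)) (m+[n∸m]≡n i≤j) ⟨
      toℕ i + δ + (2 * n ∸ δ)   ≡⟨ +-assoc (toℕ i) δ _ ⟩
      toℕ i + (δ + (2 * n ∸ δ)) ≡⟨ cong (toℕ i +_) (m+[n∸m]≡n δ≤2n) ⟩
      toℕ i + 2 * n             ∎

  module _ (1<x : 1 < x) (x<n : x < n) where

    open Graph (C₂ₙ[ x ,1, n ] 1<x x<n)

    proper : ∀ {i j} → Adj i j → colour i ≢ colour j
    proper {i} {j} ij with ≤-total (toℕ i) (toℕ j)
    ... | inj₁ i≤j = proper-≤ {i} {j} ij i≤j
    ... | inj₂ j≤i = ≢-sym (proper-≤ {j} {i} (Adj-sym {i} {j} ij) j≤i)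

    wordRepresentable : WordRepresentable (C₂ₙ[ x ,1, n ] 1<x x<n)
    wordRepresentable = ThreeColoured.wordRepresentable (C₂ₙ[ x ,1, n ] 1<x x<n)
      (λ i j → jump? (circularDistance i j)) colour (λ {i} {j} → proper {i} {j})

-- Parameters from the congruences.

parametrise : ∀ n x → n % 3 ≡ 2 → x % 3 ≡ 1 → 2 * x < n →
              ∃[ b ] ∃[ d′ ] x ≡ 1 + b * 3 × n ≡ 2 * (1 + b * 3) + 3 * suc d′
parametrise n x n≡2 x≡1 2x<n = b , d′ , x≡ , (begin
  n                               ≡⟨ n≡ ⟩
  2 + a * 3                       ≡⟨ cong (λ e → 2 + e * 3) (m+[n∸m]≡n 2b<a) ⟨
  2 + (suc (2 * b) + d′) * 3      ≡⟨ lemma b d′ ⟩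
  2 * (1 + b * 3) + 3 * suc d′    ∎)
  where
  open ≡-Reasoning
  a = n / 3
  b = x / 3
  -- From n = 2 + 3a and x = 1 + 3b one gets n - 2x = 3(a - 2b), so d = a - 2b. The truncated
  -- subtraction is exact because 2x < n forces 2b < a.
  d′ = a ∸ suc (2 * b)

  n≡ : n ≡ 2 + a * 3
  n≡ = trans (m≡m%n+[m/n]*n n 3) (cong (_+ a * 3) n≡2)

  x≡ : x ≡ 1 + b * 3
  x≡ = trans (m≡m%n+[m/n]*n x 3) (cong (_+ b * 3) x≡1)

  double : ∀ b → 2 * (1 + b * 3) ≡ 2 + 2 * b * 3
  double = solve-∀

  2b<a : 2 * b < a
  2b<a = *-cancelʳ-< 3 (2 * b) a (+-cancelˡ-< 2 _ _
    (subst₂ _<_ (trans (cong (2 *_) x≡) (double b)) n≡ 2x<n))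

  lemma : ∀ b d′ → 2 + (1 + 2 * b + d′) * 3 ≡ 2 * (1 + b * 3) + 3 * (1 + d′)
  lemma = solve-∀

theorem26 : (n x : ℕ) (1<x : 1 < x) (x<n : x < n) →
    n % 3 ≡ 2 → x % 3 ≡ 1 → 2 * x < n →
    WordRepresentable (C₂ₙ[ x ,1, n ] 1<x x<n)
theorem26 n x 1<x x<n n≡2 x≡1 2x<n with parametrise n x n≡2 x≡1 2x<n
... | b , d′ , refl , refl = Colouring.wordRepresentable b d′ 1<x x<n
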